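{- For integers $s\ge 2$ define $c_{2,1}(s)=9^{s-2}$, $c_{2,0}(s)=9^{s-2}-1$, $c_{1,1}(s)=4\cdot 9^{s-2}$, $c_{1,0}(s)=2+(16(s-2)-2)\,9^{s-2}$, $c_{0,1}(s)=4\cdot 9^{s-2}$, $c_{0,0}(s)=-1+9\cdot 81^{s-2}-(8+16(s-2))\,9^{s-2}$, and $c_{i,j}(s)=0$ for all other $0\le i,j\le 2$. Then: (a) viewing each $c_{i,j}$ as a sequence in $s$ and letting $E$ be the shift operator $E(G_s)=G_{s+1}$, the sequence $c_{0,0}$ is annihilated by $(E-81)(E-9)^2(E-1)$ and satisfies $G_s=100G_{s-1}-1638G_{s-2}+8100G_{s-3}-6561G_{s-4}$; $c_{0,1}$ is annihilated by $(E-1)(E-9)$ and satisfies $G_s=10G_{s-1}-9G_{s-2}$; $c_{1,0}$ is annihilated by $(E-9)^2(E-1)$ and satisfies $G_s=19G_{s-1}-99G_{s-2}+81G_{s-3}$; $c_{1,1}$ is annihilated by $E-9$ and satisfies $G_s=9G_{s-1}$; $c_{2,0}$ is annihilated by $(E-1)(E-9)$ and satisfies $G_s=10G_{s-1}-9G_{s-2}$; $c_{2,1}$ is annihilated by $E-9$ and satisfies $G_s=9G_{s-1}$. (b) With $$c^M_2(s,X_1,X_2)=\frac{\sum_{0\le i,j\le 2}c_{i,j}(s)\,X_1^iX_2^j}{\left(3\cdot 9^{s-2}-1+X_1\right)^2},$$ one has $C^M_{2,s}=c^M_2(s,X_1,X_2)$ for every $s\ge 2$.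
   Context: An operator $A$ in the shift operator $E$ annihilates a sequence $G=(G_s)$ if applying $A$ (with $E(G_s)=G_{s+1}$, products meaning composition) yields the zero sequence. An $n$-grid is a graph isomorphic to the graph whose vertices are the integer points $(2r+s,s)$ with $0\le r\le n$, $0\le s\le n-r$, two vertices $(x,y),(x',y')$ being adjacent iff $(x'-x,y'-y)\in\{(1,1),(2,0),(1,-1)\}$. Its upright unit triangles are indexed $T_{r,d}$ ($r=1,\dots,n$ the row from the apex downward, $d=1,\dots,r$ the position from the left), each with left, right and base edges $L,R,B$; $T_{r,d,e}$ denotes the label (resistance) of edge $e$. Every edge lies in exactly one upright triangle. Row reduction turns a labelled $n$-grid into a labelled $(n-1)$-grid: (1) Δ–Y transform every upright triangle, the spoke at the vertex shared by triangle edges $x,y$ getting label $\Delta(x,y,z)=xy/(x+y+z)$ ($z$ the third edge); (2) delete the spokes at the three corners; (3) merge consecutive spokes at each remaining degree-two boundary vertex into one edge labelled by their sum; (4) Y–Δ transform each remaining star with spokes $a,b,c$, the edge opposite spoke $a$ getting label $Y(a,b,c)=(ab+bc+ca)/a$. The result is an $(n-1)$-grid on the centres of the parent's upright triangles. $T^m_{r,d,e}$ denotes labels after $m$ reductions. Numerical circuit array: for the all-one $n$-grid ($n$ large, e.g. $n\ge 4j-2$), $C_{i,j}=T^j_{2j-1,\,j-\lfloor(i+1)/2\rfloor,\,e}$ for $j\ge1$, $0\le i\le 2(j-1)$, with $e=L$ for $i$ even, $e=R$ for $i$ odd. The multivariable circuit array $C^M$ is computed in the same way, one reduction at a time, but with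 the entries of the left-side diagonal replaced by indeterminates: after the first reduction the boundary label $2/3=C_{0,1}=T^1_{1,1,L}$ is replaced by an indeterminate $X_1$, and for each $i\ge 2$ the left-side diagonal value $C_{2(i-1),i}=T^i_{2i-1,1,L}$ is replaced by an indeterminate $X_i$ (so $C^M_{2,2}=X_2$); all other entries are then computed symbolically by the reduction formulas, so that $C^M_{i,j}$ is a rational function of $X_1,X_2,\dots$. -}

module Defs where

open import Data.Nat as ℕ using (ℕ; zero; suc; _∸_; _≡ᵇ_; _≤ᵇ_; ⌊_/2⌋)
open import Data.Integer as ℤ using (ℤ; +_; +[1+_]; -[1+_])
open import Data.Rational as ℚ using (ℚ; mkℚ; 0ℚ; 1ℚ; 1/_; _+_; _*_; _/_)
open import Relation.Binary.PropositionalEquality using (_≡_)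
open import Data.Bool using (Bool; true; false; if_then_else_; _∧_)

-- Total division on ℚ (x ÷' 0 = 0).  Only ever applied to positive
-- denominators in the statement (all labels are positive resistances).

inv : ℚ → ℚ
inv (mkℚ (+ zero) _ _)     = 0ℚ
inv q@(mkℚ +[1+ _ ] _ _)   = 1/ q
inv q@(mkℚ -[1+ _ ] _ _)   = 1/ q

infixl 7 _÷'_
_÷'_ : ℚ → ℚ → ℚ
p ÷' q = p * inv q

ιℤ : ℤ → ℚ
ιℤ z = z / 1

-- Upright triangle T_{r,d} (row r from the apex, d-th
-- from the left, 1 ≤ d ≤ r ≤ n) has edges L, R, B.  A labelling of an
-- n-grid is a function r d e ↦ T_{r,d,e}; values outside 1 ≤ d ≤ r ≤ n
-- are irrelevant.

data Edge : Set where
  L R B : Edge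

Labels : Set
Labels = ℕ → ℕ → Edge → ℚ

Δ : ℚ → ℚ → ℚ → ℚ
Δ x y z = (x * y) ÷' (x + y + z)

Yf : ℚ → ℚ → ℚ → ℚ
Yf a b c = (a * b + b * c + c * a) ÷' a

-- spokes after Δ–Y of T_{r,d}: at the top vertex (edges L,R), the
-- bottom-left vertex (edges L,B) and the bottom-right vertex (edges R,B)
spokeTop spokeBL spokeBR : Labels → ℕ → ℕ → ℚ
spokeTop T r d = Δ (T r d L) (T r d R) (T r d B)
spokeBL  T r d = Δ (T r d L) (T r d B) (T r d R)
spokeBR  T r d = Δ (T r d R) (T r d B) (T r d L)

-- The new (n-1)-grid has vertex c_{r,d} = centre of the old
-- T_{r,d}; its triangle T'_{r,d} has top c_{r,d}, bottom-left c_{r+1,d},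
-- bottom-right c_{r+1,d+1}.  Each new edge comes either from merging two
-- spokes at a degree-two boundary vertex (step 3) or from the Y–Δ
-- transform of the star at an interior vertex (step 4).
reduce : (n : ℕ) → Labels → Labels
reduce n T r d L =
  if d ≡ᵇ 1
  then spokeBL T r 1 + spokeTop T (suc r) 1
  else Yf (spokeBR T r (d ∸ 1)) (spokeBL T r d) (spokeTop T (suc r) d)
reduce n T r d R =
  if d ≡ᵇ r
  then spokeBR T r r + spokeTop T (suc r) (suc r)
  else Yf (spokeBL T r (suc d)) (spokeBR T r d) (spokeTop T (suc r) (suc d))
reduce n T r d B =
  if suc r ≡ᵇ n
  then spokeBR T n d + spokeBL T n (suc d)
  else Yf (spokeTop T (suc (suc r)) (suc d)) (spokeBL T (suc r) (suc d))
          (spokeBR T (suc r) d)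

allOne : Labels
allOne _ _ _ = 1ℚ

isL : Edge → Bool
isL L = true
isL R = false
isL B = false

-- After the m-th reduction, the left-side value C_{2(m-1),m} (which is
-- the common value of T^m_{r,1,L} for all rows r ≥ 2m-1) is replaced by
-- the indeterminate x = X_m.
replaceLeft : ℕ → ℚ → Labels → Labels
replaceLeft m x T r d e =
  if (d ≡ᵇ 1) ∧ isL e ∧ (2 ℕ.* m ∸ 1 ≤ᵇ r) then x else T r d e

-- gridM n X m : labels T^m of the multivariable computation started from
-- the all-one n-grid, with X_i evaluated at the rational X i.
gridM : (n : ℕ) → (ℕ → ℚ) → ℕ → Labels
gridM n X zero    = allOne
gridM n X (suc m) = replaceLeft (suc m) (X (suc m)) (reduce (n ∸ m) (gridM n X m))

edgeOf : ℕ → Edge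
edgeOf zero          = L
edgeOf (suc zero)    = R
edgeOf (suc (suc i)) = edgeOf i

CM : (n : ℕ) → (ℕ → ℚ) → ℕ → ℕ → ℚ
CM n X i j = gridM n X j (2 ℕ.* j ∸ 1) (j ∸ ⌊ suc i /2⌋) (edgeOf i)

c : ℕ → ℕ → ℕ → ℤ
c 2 1 s = + (9 ℕ.^ (s ∸ 2))
c 2 0 s = + (9 ℕ.^ (s ∸ 2)) ℤ.- + 1
c 1 1 s = + (4 ℕ.* 9 ℕ.^ (s ∸ 2))
c 1 0 s = + 2 ℤ.+ (+ (16 ℕ.* (s ∸ 2)) ℤ.- + 2) ℤ.* + (9 ℕ.^ (s ∸ 2))
c 0 1 s = + (4 ℕ.* 9 ℕ.^ (s ∸ 2))
c 0 0 s = -[1+ 0 ] ℤ.+ + (9 ℕ.* 81 ℕ.^ (s ∸ 2))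
            ℤ.- + ((8 ℕ.+ 16 ℕ.* (s ∸ 2)) ℕ.* 9 ℕ.^ (s ∸ 2))
c _ _ _ = + 0

cM2 : ℕ → ℚ → ℚ → ℚ
cM2 s x₁ x₂ = numer ÷' (den * den)
  where
  pow : ℚ → ℕ → ℚ
  pow x zero    = 1ℚ
  pow x (suc k) = x * pow x k
  term : ℕ → ℕ → ℚ
  term i j = ιℤ (c i j s) * pow x₁ i * pow x₂ j
  numer = term 0 0 + term 0 1 + term 0 2 + term 1 0 + term 1 1 + term 1 2
          + term 2 0 + term 2 1 + term 2 2
  den = ιℤ (+ (3 ℕ.* 9 ℕ.^ (s ∸ 2)) ℤ.- + 1) + x₁

Seq : Set
Seq = ℕ → ℤ

E-_ : ℤ → Seq → Seq
(E- a) G s = G (suc s) ℤ.- a ℤ.* G s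

-- A (an operator in E, products = composition) annihilates the
-- sequence G = (G_s)_{s ≥ 2}
Annihilates : (Seq → Seq) → Seq → Set
Annihilates A G = ∀ s → 2 ℕ.≤ s → A G s ≡ + 0

-- Away from the boundary, the labels of a reduced all-one grid do not depend on the row, so a
-- row reduction acts on the columns by a fixed local rule.  After m + 1 reductions all labels in
-- the relevant region are 1 except on two adjacent diagonals, whose labels a m, b m, γ m obey
-- one-step recurrences in which X₁ and X₂ enter only as initial values.  Clearing denominators
-- solves them: a m · 9^m = 9^m - 1 + X₁, and γ m · (3·9^m - 1 + X₁)² is the numerator N of c^M_2,
-- because N(9U, T + 1) = 2 S D′ + 6 D S + 9 N(U, T) with D = 3U - 1 + X₁, S = 9U - 1 + X₁ and
-- D′ = 27U - 1 + X₁.  For (a), each c_{i,j}(k + 2) is a combination of 1, 9^k, k 9^k and 81^k;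
-- E - a acts linearly on the four coefficients, the given products send them to zero, and
-- expanding the products gives the recurrences.
module Submission where

module Literals where
  open import Agda.Builtin.FromNat public
  open import Agda.Builtin.FromNeg public
  open import Data.Unit.Base public using (tt)
  open import Data.Nat.Base using (ℕ)
  open import Data.Integer.Base using (ℤ)
  open import Data.Rational.Base using (ℚ)
  import Data.Nat.Literals as ℕ
  import Data.Integer.Literals as ℤ
  import Data.Rational.Literals as ℚ

  instance
    ℕ-number : Number ℕ
    ℕ-number = ℕ.number
    ℤ-number : Number ℤ
    ℤ-number = ℤ.number
    ℤ-negative : Negative ℤ
    ℤ-negative = ℤ.negative
    ℚ-number : Number ℚ
    ℚ-number = ℚ.number
    ℚ-negative : Negative ℚ
    ℚ-negative = ℚ.negative

module ShiftOperators where
  open Literals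
  open import Defs using (Seq; E-_; Annihilates; c)
  open import Data.Integer using (ℤ; +_; _+_; _-_; _*_; _^_)
  open import Data.Integer.Properties using (pos-+; pos-*; i-j≡0⇒i≡j)
  open import Data.Integer.Tactic.RingSolver using (solve-∀)
  open import Data.List using (List; []; _∷_; foldr)
  open import Data.Nat as ℕ using (zero; suc; _∸_; _≤_; s≤s)
  open import Function using (id; _∘_)
  open import Relation.Binary.PropositionalEquality

  data Coefficients : Set where
    ⟨_,_,_,_⟩ : ℤ → ℤ → ℤ → ℤ → Coefficients

  expPoly : Coefficients → Seq
  expPoly ⟨ α , β , γ , δ ⟩ k = α + β * 9 ^ k + γ * (+ k * 9 ^ k) + δ * 81 ^ k

  E-coefficients : ℤ → Coefficients → Coefficients
  E-coefficients a ⟨ α , β , γ , δ ⟩ =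
    ⟨ (1 - a) * α , (9 - a) * β + 9 * γ , (9 - a) * γ , (81 - a) * δ ⟩

  E-expPoly : ∀ a v → (E- a) (expPoly v) ≗ expPoly (E-coefficients a v)
  E-expPoly a ⟨ α , β , γ , δ ⟩ k = identity α β γ δ a (9 ^ k) (81 ^ k) (+ k)
    where
    identity : ∀ α β γ δ a u w t →
      α + β * (9 * u) + γ * ((1 + t) * (9 * u)) + δ * (81 * w)
        - a * (α + β * u + γ * (t * u) + δ * w)
        ≡ (1 - a) * α + ((9 - a) * β + 9 * γ) * u + (9 - a) * γ * (t * u) + (81 - a) * δ * w
    identity = solve-∀

  E-cong : ∀ a {F G : Seq} → F ≗ G → (E- a) F ≗ (E- a) G
  E-cong a F≗G s = cong₂ (λ p q → p - a * q) (F≗G (suc s)) (F≗G s)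

  E-product : List ℤ → Seq → Seq
  E-product []       = id
  E-product (a ∷ as) = E- a ∘ E-product as

  E-product-cong : ∀ as {F G : Seq} → F ≗ G → E-product as F ≗ E-product as G
  E-product-cong []       F≗G = F≗G
  E-product-cong (a ∷ as) F≗G = E-cong a (E-product-cong as F≗G)

  E-product-expPoly : ∀ as v → E-product as (expPoly v) ≗ expPoly (foldr E-coefficients v as)
  E-product-expPoly []       v k = refl
  E-product-expPoly (a ∷ as) v k =
    trans (E-cong a (E-product-expPoly as v) k) (E-expPoly a (foldr E-coefficients v as) k)

  E-product-shift : ∀ as G → E-product as G ∘ suc ≗ E-product as (G ∘ suc)
  E-product-shift []       G k = refl
  E-product-shift (a ∷ as) G k =
    cong₂ (λ p q → p - a * q) (E-product-shift as G (suc k)) (E-product-shift as G k)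

  annihilates-expPoly : ∀ as v G → (∀ k → G (2 ℕ.+ k) ≡ expPoly v k) →
                        foldr E-coefficients v as ≡ ⟨ 0 , 0 , 0 , 0 ⟩ →
                        Annihilates (E-product as) G
  annihilates-expPoly as v G closed vanishes (suc (suc k)) (s≤s (s≤s _)) = begin
    E-product as G (2 ℕ.+ k)                ≡⟨ E-product-shift as G (suc k) ⟩
    E-product as (G ∘ suc) (suc k)          ≡⟨ E-product-shift as (G ∘ suc) k ⟩
    E-product as (G ∘ suc ∘ suc) k          ≡⟨ E-product-cong as closed k ⟩
    E-product as (expPoly v) k              ≡⟨ E-product-expPoly as v k ⟩
    expPoly (foldr E-coefficients v as) k   ≡⟨ cong (λ w → expPoly w k) vanishes ⟩
    expPoly ⟨ 0 , 0 , 0 , 0 ⟩ k             ≡⟨⟩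
    + 0                                     ∎
    where open ≡-Reasoning

  vieta₂ : ∀ a b G s → E-product (a ∷ b ∷ []) G s ≡
           G (2 ℕ.+ s) - ((a + b) * G (1 ℕ.+ s) - a * b * G s)
  vieta₂ a b G s = identity a b (G s) (G (1 ℕ.+ s)) (G (2 ℕ.+ s))
    where
    identity : ∀ a b g₀ g₁ g₂ →
      g₂ - b * g₁ - a * (g₁ - b * g₀) ≡ g₂ - ((a + b) * g₁ - a * b * g₀)
    identity = solve-∀

  vieta₃ : ∀ a b c G s → E-product (a ∷ b ∷ c ∷ []) G s ≡
           G (3 ℕ.+ s) - ((a + b + c) * G (2 ℕ.+ s) - (a * b + b * c + c * a) * G (1 ℕ.+ s)
                          + a * b * c * G s)
  vieta₃ a b c G s =
    trans (cong₂ (λ p q → p - a * q) (vieta₂ b c G (1 ℕ.+ s)) (vieta₂ b c G s))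
          (identity a b c (G s) (G (1 ℕ.+ s)) (G (2 ℕ.+ s)) (G (3 ℕ.+ s)))
    where
    identity : ∀ a b c g₀ g₁ g₂ g₃ →
      g₃ - ((b + c) * g₂ - b * c * g₁) - a * (g₂ - ((b + c) * g₁ - b * c * g₀))
        ≡ g₃ - ((a + b + c) * g₂ - (a * b + b * c + c * a) * g₁ + a * b * c * g₀)
    identity = solve-∀

  vieta₄ : ∀ a b c d G s → E-product (a ∷ b ∷ c ∷ d ∷ []) G s ≡
           G (4 ℕ.+ s) - ((a + b + c + d) * G (3 ℕ.+ s)
                          - (a * b + a * c + a * d + b * c + b * d + c * d) * G (2 ℕ.+ s)
                          + (a * b * c + a * b * d + a * c * d + b * c * d) * G (1 ℕ.+ s)
                          - a * b * c * d * G s)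
  vieta₄ a b c d G s =
    trans (cong₂ (λ p q → p - a * q) (vieta₃ b c d G (1 ℕ.+ s)) (vieta₃ b c d G s))
          (identity a b c d (G s) (G (1 ℕ.+ s)) (G (2 ℕ.+ s)) (G (3 ℕ.+ s)) (G (4 ℕ.+ s)))
    where
    identity : ∀ a b c d g₀ g₁ g₂ g₃ g₄ →
      g₄ - ((b + c + d) * g₃ - (b * c + c * d + d * b) * g₂ + b * c * d * g₁)
        - a * (g₃ - ((b + c + d) * g₂ - (b * c + c * d + d * b) * g₁ + b * c * d * g₀))
        ≡ g₄ - ((a + b + c + d) * g₃ - (a * b + a * c + a * d + b * c + b * d + c * d) * g₂
                + (a * b * c + a * b * d + a * c * d + b * c * d) * g₁ - a * b * c * d * g₀)
    identity = solve-∀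

  recurrence₁ : ∀ a G → Annihilates (E-product (a ∷ [])) G →
                ∀ s → 3 ≤ s → G s ≡ a * G (s ∸ 1)
  recurrence₁ a G ann (suc s) (s≤s 2≤s) = i-j≡0⇒i≡j _ _ (ann s 2≤s)

  recurrence₂ : ∀ a b G → Annihilates (E-product (a ∷ b ∷ [])) G →
                ∀ s → 4 ≤ s → G s ≡ (a + b) * G (s ∸ 1) - a * b * G (s ∸ 2)
  recurrence₂ a b G ann (suc (suc s)) (s≤s (s≤s 2≤s)) =
    i-j≡0⇒i≡j _ _ (trans (sym (vieta₂ a b G s)) (ann s 2≤s))

  recurrence₃ : ∀ a b c G → Annihilates (E-product (a ∷ b ∷ c ∷ [])) G →
                ∀ s → 5 ≤ s → G s ≡ (a + b + c) * G (s ∸ 1) - (a * b + b * c + c * a) * G (s ∸ 2)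
                                    + a * b * c * G (s ∸ 3)
  recurrence₃ a b c G ann (suc (suc (suc s))) (s≤s (s≤s (s≤s 2≤s))) =
    i-j≡0⇒i≡j _ _ (trans (sym (vieta₃ a b c G s)) (ann s 2≤s))

  recurrence₄ : ∀ a b c d G → Annihilates (E-product (a ∷ b ∷ c ∷ d ∷ [])) G →
                ∀ s → 6 ≤ s →
                G s ≡ (a + b + c + d) * G (s ∸ 1)
                      - (a * b + a * c + a * d + b * c + b * d + c * d) * G (s ∸ 2)
                      + (a * b * c + a * b * d + a * c * d + b * c * d) * G (s ∸ 3)
                      - a * b * c * d * G (s ∸ 4)
  recurrence₄ a b c d G ann (suc (suc (suc (suc s)))) (s≤s (s≤s (s≤s (s≤s 2≤s)))) =
    i-j≡0⇒i≡j _ _ (trans (sym (vieta₄ a b c d G s)) (ann s 2≤s))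

  pos-^ : ∀ m n → + (m ℕ.^ n) ≡ (+ m) ^ n
  pos-^ m zero    = refl
  pos-^ m (suc n) = trans (pos-* m (m ℕ.^ n)) (cong (+ m *_) (pos-^ m n))

  pos-*-^ : ∀ m b n → + (m ℕ.* b ℕ.^ n) ≡ + m * (+ b) ^ n
  pos-*-^ m b n = trans (pos-* m (b ℕ.^ n)) (cong (+ m *_) (pos-^ b n))

  c₀₀-closed : ∀ k → c 0 0 (2 ℕ.+ k) ≡ expPoly ⟨ -1 , -8 , -16 , 9 ⟩ k
  c₀₀-closed k = begin
    c 0 0 (2 ℕ.+ k)                            ≡⟨ cong₂ (λ p q → -1 + p - q) (pos-*-^ 9 81 k) cast ⟩
    -1 + 9 * 81 ^ k - (8 + 16 * + k) * 9 ^ k   ≡⟨ regroup (9 ^ k) (81 ^ k) (+ k) ⟩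
    expPoly ⟨ -1 , -8 , -16 , 9 ⟩ k            ∎
    where
    open ≡-Reasoning
    cast : + ((8 ℕ.+ 16 ℕ.* k) ℕ.* 9 ℕ.^ k) ≡ (8 + 16 * + k) * 9 ^ k
    cast = trans (pos-* (8 ℕ.+ 16 ℕ.* k) (9 ℕ.^ k))
                 (cong₂ _*_ (trans (pos-+ 8 (16 ℕ.* k)) (cong (λ z → 8 + z) (pos-* 16 k)))
                            (pos-^ 9 k))
    regroup : ∀ u w t → -1 + 9 * w - (8 + 16 * t) * u ≡ -1 + -8 * u + -16 * (t * u) + 9 * w
    regroup = solve-∀

  4·9ᵏ-closed : ∀ k → + (4 ℕ.* 9 ℕ.^ k) ≡ expPoly ⟨ 0 , 4 , 0 , 0 ⟩ k
  4·9ᵏ-closed k = trans (pos-*-^ 4 9 k) (regroup (9 ^ k) (81 ^ k) (+ k))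
    where
    regroup : ∀ u w t → 4 * u ≡ 0 + 4 * u + 0 * (t * u) + 0 * w
    regroup = solve-∀

  c₁₀-closed : ∀ k → c 1 0 (2 ℕ.+ k) ≡ expPoly ⟨ 2 , -2 , 16 , 0 ⟩ k
  c₁₀-closed k = trans (cong₂ (λ p q → 2 + (p - 2) * q) (pos-* 16 k) (pos-^ 9 k))
                       (regroup (9 ^ k) (81 ^ k) (+ k))
    where
    regroup : ∀ u w t → 2 + (16 * t - 2) * u ≡ 2 + -2 * u + 16 * (t * u) + 0 * w
    regroup = solve-∀

  c₂₀-closed : ∀ k → c 2 0 (2 ℕ.+ k) ≡ expPoly ⟨ -1 , 1 , 0 , 0 ⟩ k
  c₂₀-closed k = trans (cong (_- 1) (pos-^ 9 k)) (regroup (9 ^ k) (81 ^ k) (+ k))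
    where
    regroup : ∀ u w t → u - 1 ≡ -1 + 1 * u + 0 * (t * u) + 0 * w
    regroup = solve-∀

  c₂₁-closed : ∀ k → c 2 1 (2 ℕ.+ k) ≡ expPoly ⟨ 0 , 1 , 0 , 0 ⟩ k
  c₂₁-closed k = trans (pos-^ 9 k) (regroup (9 ^ k) (81 ^ k) (+ k))
    where
    regroup : ∀ u w t → u ≡ 0 + 1 * u + 0 * (t * u) + 0 * w
    regroup = solve-∀

  c₀₀-annihilated : Annihilates (E-product (81 ∷ 9 ∷ 9 ∷ 1 ∷ [])) (c 0 0)
  c₀₀-annihilated =
    annihilates-expPoly (81 ∷ 9 ∷ 9 ∷ 1 ∷ []) ⟨ -1 , -8 , -16 , 9 ⟩ (c 0 0) c₀₀-closed refl

  c₀₁-annihilated : Annihilates (E-product (1 ∷ 9 ∷ [])) (c 0 1)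
  c₀₁-annihilated = annihilates-expPoly (1 ∷ 9 ∷ []) ⟨ 0 , 4 , 0 , 0 ⟩ (c 0 1) 4·9ᵏ-closed refl

  c₁₀-annihilated : Annihilates (E-product (9 ∷ 9 ∷ 1 ∷ [])) (c 1 0)
  c₁₀-annihilated =
    annihilates-expPoly (9 ∷ 9 ∷ 1 ∷ []) ⟨ 2 , -2 , 16 , 0 ⟩ (c 1 0) c₁₀-closed refl

  c₁₁-annihilated : Annihilates (E-product (9 ∷ [])) (c 1 1)
  c₁₁-annihilated = annihilates-expPoly (9 ∷ []) ⟨ 0 , 4 , 0 , 0 ⟩ (c 1 1) 4·9ᵏ-closed refl

  c₂₀-annihilated : Annihilates (E-product (1 ∷ 9 ∷ [])) (c 2 0)
  c₂₀-annihilated =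
    annihilates-expPoly (1 ∷ 9 ∷ []) ⟨ -1 , 1 , 0 , 0 ⟩ (c 2 0) c₂₀-closed refl

  c₂₁-annihilated : Annihilates (E-product (9 ∷ [])) (c 2 1)
  c₂₁-annihilated = annihilates-expPoly (9 ∷ []) ⟨ 0 , 1 , 0 , 0 ⟩ (c 2 1) c₂₁-closed refl

module RationalAlgebra where
  open Literals
  open import Defs using (inv; _÷'_; ιℤ; Δ; Yf)
  open import Data.Integer as ℤ using (+_)
  import Data.Integer.Properties as ℤ
  open import Data.List using (_∷_; [])
  open import Data.Maybe.Base using (Maybe; just; nothing)
  open import Data.Nat as ℕ using (ℕ)
  open import Data.Rational using (ℚ; mkℚ; 0ℚ; _+_; _*_; _-_; -_; 1/_; Positive; toℚᵘ)
  open import Data.Rational.Properties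
  import Data.Rational.Unnormalised as ℚᵘ
  import Data.Rational.Unnormalised.Properties as ℚᵘ
  open import Function using (_$_)
  open import Level using (0ℓ)
  open import Relation.Binary.PropositionalEquality
  open import Relation.Nullary using (yes; no)
  open import Tactic.RingSolver using (solve-∀; solve)
  import Tactic.RingSolver.Core.AlmostCommutativeRing as ACR

  cong₃ : ∀ {A B C D : Set} (f : A → B → C → D) {a a′ b b′ c c′} →
          a ≡ a′ → b ≡ b′ → c ≡ c′ → f a b c ≡ f a′ b′ c′
  cong₃ f refl refl refl = refl

  ℚ-ring : ACR.AlmostCommutativeRing 0ℓ 0ℓ
  ℚ-ring = ACR.fromCommutativeRing +-*-commutativeRing isZero
    where
    isZero : ∀ x → Maybe (0ℚ ≡ x)
    isZero x with 0ℚ ≟ x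
    ... | yes 0≡x = just 0≡x
    ... | no  _   = nothing

  ⅓ : ℚ
  ⅓ = 1 ÷' 3

  inv≡1/ : ∀ q .{{_ : Positive q}} → inv q ≡ (1/ q) {{pos⇒nonZero q}}
  inv≡1/ (mkℚ ℤ.+[1+ _ ] _ _) = refl

  ÷'-*-cancel : ∀ p q .{{_ : Positive q}} → p ÷' q * q ≡ p
  ÷'-*-cancel p q = begin
    p * inv q * q    ≡⟨ *-assoc p (inv q) q ⟩
    p * (inv q * q)  ≡⟨ cong (λ z → p * (z * q)) (inv≡1/ q) ⟩
    p * (1/ q * q)   ≡⟨ cong (p *_) (*-inverseˡ q) ⟩
    p * 1            ≡⟨ *-identityʳ p ⟩
    p                ∎
    where
    open ≡-Reasoning
    instance _ = pos⇒nonZero q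

  *-÷'-cancel : ∀ p q .{{_ : Positive q}} → p * q ÷' q ≡ p
  *-÷'-cancel p q = begin
    p * q * inv q    ≡⟨ *-assoc p q (inv q) ⟩
    p * (q * inv q)  ≡⟨ cong (λ z → p * (q * z)) (inv≡1/ q) ⟩
    p * (q * 1/ q)   ≡⟨ cong (p *_) (*-inverseʳ q) ⟩
    p * 1            ≡⟨ *-identityʳ p ⟩
    p                ∎
    where
    open ≡-Reasoning
    instance _ = pos⇒nonZero q

  ÷'-unique : ∀ {a p} q .{{_ : Positive q}} → a * q ≡ p → a ≡ p ÷' q
  ÷'-unique {a} q aq≡p = trans (sym (*-÷'-cancel a q)) (cong (_÷' q) aq≡p)

  *-cancelʳ-pos : ∀ {a b} q .{{_ : Positive q}} → a * q ≡ b * q → a ≡ b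
  *-cancelʳ-pos {b = b} q aq≡bq = trans (÷'-unique q aq≡bq) (*-÷'-cancel b q)

  inv-positive : ∀ q .{{_ : Positive q}} → Positive (inv q)
  inv-positive q = subst Positive (sym (inv≡1/ q)) (1/pos⇒pos q)

  Δ-positive : ∀ x y z .{{_ : Positive x}} .{{_ : Positive y}} .{{_ : Positive z}} →
               Positive (Δ x y z)
  Δ-positive x y z = pos*pos⇒pos (x * y) (inv (x + y + z))
    where
    instance
      _ = pos*pos⇒pos x y
      _ = pos+pos⇒pos x y
      _ = pos+pos⇒pos (x + y) z
      _ = inv-positive (x + y + z)

  Yf-positive : ∀ a b c .{{_ : Positive a}} .{{_ : Positive b}} .{{_ : Positive c}} →
                Positive (Yf a b c)
  Yf-positive a b c = pos*pos⇒pos (a * b + b * c + c * a) (inv a)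
    where
    instance
      _ = pos*pos⇒pos a b
      _ = pos*pos⇒pos b c
      _ = pos*pos⇒pos c a
      _ = pos+pos⇒pos (a * b) (b * c)
      _ = pos+pos⇒pos (a * b + b * c) (c * a)
      _ = inv-positive a

  Δ-clear : ∀ x y z .{{_ : Positive x}} .{{_ : Positive y}} .{{_ : Positive z}} →
            Δ x y z * (x + y + z) ≡ x * y
  Δ-clear x y z = ÷'-*-cancel (x * y) (x + y + z)
    where
    instance
      _ = pos+pos⇒pos x y
      _ = pos+pos⇒pos (x + y) z

  Yf-clear : ∀ a b c .{{_ : Positive a}} → Yf a b c * a ≡ a * b + b * c + c * a
  Yf-clear a b c = ÷'-*-cancel (a * b + b * c + c * a) a

  Yf-swap : ∀ a b c → Yf a b c ≡ Yf a c b
  Yf-swap a b c = cong (_÷' a) (swap a b c)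
    where
    swap : ∀ a b c → a * b + b * c + c * a ≡ a * c + c * b + b * a
    swap = solve-∀ ℚ-ring

  ιℤ-toℚᵘ : ∀ z → toℚᵘ (ιℤ z) ℚᵘ.≃ ℚᵘ.mkℚᵘ z 0
  ιℤ-toℚᵘ z = toℚᵘ-fromℚᵘ (ℚᵘ.mkℚᵘ z 0)

  ιℤ-homo-+ : ∀ a b → ιℤ (a ℤ.+ b) ≡ ιℤ a + ιℤ b
  ιℤ-homo-+ a b = toℚᵘ-injective $ ℚᵘ.≃-trans (ιℤ-toℚᵘ (a ℤ.+ b)) $ ℚᵘ.≃-trans sum $
    ℚᵘ.≃-sym (ℚᵘ.≃-trans (toℚᵘ-homo-+ (ιℤ a) (ιℤ b)) (ℚᵘ.+-cong (ιℤ-toℚᵘ a) (ιℤ-toℚᵘ b)))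
    where
    sum : ℚᵘ.mkℚᵘ (a ℤ.+ b) 0 ℚᵘ.≃ ℚᵘ.mkℚᵘ a 0 ℚᵘ.+ ℚᵘ.mkℚᵘ b 0
    sum = ℚᵘ.*≡* (cong (ℤ._* + 1)
                       (cong₂ ℤ._+_ (sym (ℤ.*-identityʳ a)) (sym (ℤ.*-identityʳ b))))

  ιℤ-homo-* : ∀ a b → ιℤ (a ℤ.* b) ≡ ιℤ a * ιℤ b
  ιℤ-homo-* a b = toℚᵘ-injective $ ℚᵘ.≃-trans (ιℤ-toℚᵘ (a ℤ.* b)) $
    ℚᵘ.≃-sym (ℚᵘ.≃-trans (toℚᵘ-homo-* (ιℤ a) (ιℤ b)) (ℚᵘ.*-cong (ιℤ-toℚᵘ a) (ιℤ-toℚᵘ b)))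

  ιℤ-homo‿- : ∀ a → ιℤ (ℤ.- a) ≡ - ιℤ a
  ιℤ-homo‿- a = toℚᵘ-injective $ ℚᵘ.≃-trans (ιℤ-toℚᵘ (ℤ.- a)) $
    ℚᵘ.≃-sym (ℚᵘ.≃-trans (toℚᵘ-homo‿- (ιℤ a)) (ℚᵘ.-‿cong (ιℤ-toℚᵘ a)))

  ιℤ-homo-− : ∀ a b → ιℤ (a ℤ.- b) ≡ ιℤ a - ιℤ b
  ιℤ-homo-− a b = trans (ιℤ-homo-+ a (ℤ.- b)) (cong (λ z → ιℤ a + z) (ιℤ-homo‿- b))

  ιℕ : ℕ → ℚ
  ιℕ n = ιℤ (+ n)

  ιℕ-homo-+ : ∀ m n → ιℕ (m ℕ.+ n) ≡ ιℕ m + ιℕ n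
  ιℕ-homo-+ m n = trans (cong ιℤ (ℤ.pos-+ m n)) (ιℤ-homo-+ (+ m) (+ n))

  ιℕ-homo-* : ∀ m n → ιℕ (m ℕ.* n) ≡ ιℕ m * ιℕ n
  ιℕ-homo-* m n = trans (cong ιℤ (ℤ.pos-* m n)) (ιℤ-homo-* (+ m) (+ n))

  linear-combination₁ : ∀ {u v p q : ℚ} c → p ≡ q → u ≡ v + c * (p - q) → u ≡ v
  linear-combination₁ {v = v} {q = q} c refl e = trans e (solve (v ∷ c ∷ q ∷ []) ℚ-ring)

  linear-combination₂ : ∀ {u v p₁ q₁ p₂ q₂ : ℚ} c₁ c₂ → p₁ ≡ q₁ → p₂ ≡ q₂ →
                        u ≡ v + c₁ * (p₁ - q₁) + c₂ * (p₂ - q₂) → u ≡ v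
  linear-combination₂ {v = v} {q₁ = q₁} {q₂ = q₂} c₁ c₂ refl refl e =
    trans e (solve (v ∷ c₁ ∷ c₂ ∷ q₁ ∷ q₂ ∷ []) ℚ-ring)

  linear-combination₃ : ∀ {u v p₁ q₁ p₂ q₂ p₃ q₃ : ℚ} c₁ c₂ c₃ →
                        p₁ ≡ q₁ → p₂ ≡ q₂ → p₃ ≡ q₃ →
                        u ≡ v + c₁ * (p₁ - q₁) + c₂ * (p₂ - q₂) + c₃ * (p₃ - q₃) → u ≡ v
  linear-combination₃ {v = v} {q₁ = q₁} {q₂ = q₂} {q₃ = q₃} c₁ c₂ c₃ refl refl refl e =
    trans e (solve (v ∷ c₁ ∷ c₂ ∷ c₃ ∷ q₁ ∷ q₂ ∷ q₃ ∷ []) ℚ-ring)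

module RowReduction where
  open Literals
  open import Defs
  open RationalAlgebra using (cong₃; ⅓; Yf-swap)
  open import Data.Bool using (true; false; if_then_else_; _∧_; T)
  open import Data.Bool.Properties using (∧-zeroʳ; T-≡)
  open import Data.Empty using (⊥-elim)
  open import Data.Nat using (ℕ; zero; suc; _+_; _*_; _∸_; _≡ᵇ_; _≤ᵇ_; _≤_; _<_; z≤n; s≤s)
  open import Data.Nat.Properties
  open import Data.Nat.Tactic.RingSolver using (solve-∀)
  open import Data.Rational using (ℚ)
  open import Function using (Equivalence)
  open import Relation.Binary.PropositionalEquality

  ≢⇒≡ᵇ-false : ∀ {m n} → m ≢ n → (m ≡ᵇ n) ≡ false
  ≢⇒≡ᵇ-false {m} {n} m≢n with m ≡ᵇ n in eq
  ... | false = refl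
  ... | true  = ⊥-elim (m≢n (≡ᵇ⇒≡ m n (subst T (sym eq) _)))

  if-false : ∀ {A : Set} {b} {x y : A} → b ≡ false → (if b then x else y) ≡ y
  if-false refl = refl

  Tri : Set
  Tri = Edge → ℚ

  triangle : ℚ → ℚ → ℚ → Tri
  triangle l r b L = l
  triangle l r b R = r
  triangle l r b B = b

  ones : Tri
  ones _ = 1

  topSpoke leftSpoke rightSpoke : Tri → ℚ
  topSpoke   t = Δ (t L) (t R) (t B)
  leftSpoke  t = Δ (t L) (t B) (t R)
  rightSpoke t = Δ (t R) (t B) (t L)

  module _ {t t′ : Tri} (t≗t′ : t ≗ t′) where
    topSpoke-cong : topSpoke t ≡ topSpoke t′
    topSpoke-cong = cong₃ Δ (t≗t′ L) (t≗t′ R) (t≗t′ B)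

    leftSpoke-cong : leftSpoke t ≡ leftSpoke t′
    leftSpoke-cong = cong₃ Δ (t≗t′ L) (t≗t′ B) (t≗t′ R)

    rightSpoke-cong : rightSpoke t ≡ rightSpoke t′
    rightSpoke-cong = cong₃ Δ (t≗t′ R) (t≗t′ B) (t≗t′ L)

  -- The labels that `reduce` gives triangle d when the labels of the old triangles
  -- d - 1, d, d + 1 are l, m, r in every row involved.
  rule : Tri → Tri → Tri → Tri
  rule l m r L = Yf (rightSpoke l) (leftSpoke m) (topSpoke m)
  rule l m r R = Yf (leftSpoke r) (rightSpoke m) (topSpoke r)
  rule l m r B = Yf (topSpoke r) (leftSpoke r) (rightSpoke m)

  -- The new edge e of triangle (r, d) comes from a Y–Δ transform, not from a merge.
  Interior : ℕ → ℕ → ℕ → Edge → Set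
  Interior n r d L = d ≢ 1
  Interior n r d R = d ≢ r
  Interior n r d B = suc r ≢ n

  -- The new edge e of row r only involves the old rows r, …, r + 2 - δ e.
  δ : Edge → ℕ
  δ L = 1
  δ R = 1
  δ B = 0

  reduce-local : ∀ {n T r} m o (P : ℕ → Tri) e → Interior n r (suc o + m) e →
    (∀ i j → i + δ e ≤ 2 → j ≤ 2 → T (i + r) (j + o + m) ≗ P (j + o)) →
    reduce n T r (suc o + m) e ≡ rule (P o) (P (suc o)) (P (2 + o)) e
  reduce-local m o P L int old = trans (if-false (≢⇒≡ᵇ-false int))
    (cong₃ Yf (rightSpoke-cong (old 0 0 (s≤s z≤n) z≤n))
              (leftSpoke-cong (old 0 1 (s≤s z≤n) (s≤s z≤n)))
              (topSpoke-cong (old 1 1 ≤-refl (s≤s z≤n))))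
  reduce-local m o P R int old = trans (if-false (≢⇒≡ᵇ-false int))
    (cong₃ Yf (leftSpoke-cong (old 0 2 (s≤s z≤n) ≤-refl))
              (rightSpoke-cong (old 0 1 (s≤s z≤n) (s≤s z≤n)))
              (topSpoke-cong (old 1 2 ≤-refl ≤-refl)))
  reduce-local m o P B int old = trans (if-false (≢⇒≡ᵇ-false int))
    (cong₃ Yf (topSpoke-cong (old 2 2 ≤-refl ≤-refl))
              (leftSpoke-cong (old 1 2 (s≤s z≤n) ≤-refl))
              (rightSpoke-cong (old 1 1 (s≤s z≤n) (s≤s z≤n))))

  reduce-allOne : ∀ {n r d} e → Interior n r d e → reduce n allOne r d e ≡ 1
  reduce-allOne L int = if-false (≢⇒≡ᵇ-false int)
  reduce-allOne R int = if-false (≢⇒≡ᵇ-false int)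
  reduce-allOne B int = if-false (≢⇒≡ᵇ-false int)

  replaceLeft-interior : ∀ {n r d} M x T e → Interior n r d e → replaceLeft M x T r d e ≡ T r d e
  replaceLeft-interior {r = r} M x T L int = if-false (cong (_∧ (2 * M ∸ 1 ≤ᵇ r)) (≢⇒≡ᵇ-false int))
  replaceLeft-interior {d = d} M x T R _   = if-false (∧-zeroʳ (d ≡ᵇ 1))
  replaceLeft-interior {d = d} M x T B _   = if-false (∧-zeroʳ (d ≡ᵇ 1))

  replaceLeft-corner : ∀ {r} M x T → 2 * M ∸ 1 ≤ r → replaceLeft M x T r 1 L ≡ x
  replaceLeft-corner M x T h = cong (if_then _ else _) (Equivalence.to T-≡ (≤⇒≤ᵇ h))

  -- a m = C^M_{0,m+1}, b m = C^M_{1,m+2} and γ m = C^M_{2,m+2}.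
  module Profile (x₁ x₂ : ℚ) where
    a : ℕ → ℚ
    a zero    = x₁
    a (suc m) = Yf (Δ 1 1 (a m)) ⅓ ⅓

    b : ℕ → ℚ
    b m = Yf ⅓ (Δ 1 1 (a m)) ⅓

    γ : ℕ → ℚ
    γ zero    = x₂
    γ (suc m) = Yf (Δ (b m) (b m) (γ m)) (Δ (a (suc m)) 1 1) (Δ (a (suc m)) 1 1)

    -- After m + 1 reductions, triangle (r, o + m) carries slot m o away from the boundary;
    -- slot 0 0 sits in column 0, which is not a triangle.
    slot : ℕ → ℕ → Tri
    slot m       (suc (suc o)) = ones
    slot m       (suc zero)    = triangle (a m) 1 1
    slot zero    zero          = ones
    slot (suc m) zero          = triangle (γ m) (b m) (b m)

    slot-step : ∀ m o e → (e ≡ L → 0 < o + m) →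
                rule (slot m o) (slot m (suc o)) (slot m (2 + o)) e ≡ slot (suc m) o e
    slot-step zero    zero          L corner with corner refl
    ... | ()
    slot-step (suc m) zero          L _ = refl
    slot-step m       zero          R _ = refl
    slot-step m       zero          B _ = Yf-swap ⅓ ⅓ (Δ 1 1 (a m))
    slot-step m       (suc zero)    L _ = refl
    slot-step m       (suc zero)    R _ = refl
    slot-step m       (suc zero)    B _ = refl
    slot-step m       (suc (suc o)) L _ = refl
    slot-step m       (suc (suc o)) R _ = refl
    slot-step m       (suc (suc o)) B _ = refl

  module Grid (n : ℕ) (X : ℕ → ℚ) where
    open Profile (X 1) (X 2)

    record InWindow (M r d : ℕ) (e : Edge) : Set where
      constructor window
      field
        below-diagonal : d + M ≤ r
        above-bottom   : r + 2 * M ≤ δ e + n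

    Invariant : ℕ → Set
    Invariant m = ∀ {r d o e} → d ≡ o + m → InWindow (suc m) r d e →
                  gridM n X (suc m) r d e ≡ slot m o e

    window-R : ∀ {m r d} → InWindow (suc m) r d R → d ≢ r
    window-R {m} {r} {d} (window below _) = <⇒≢ (m+n≤o⇒m≤o (suc d) (subst (_≤ r) (+-suc d m) below))

    window-B : ∀ {m r d} → InWindow (suc m) r d B → suc r ≢ n ∸ m
    window-B {m} {r} (window _ above) = <⇒≢ (m+n≤o⇒m≤o∸n (2 + r) (begin
      2 + r + m      ≤⟨ m≤m+n (2 + r + m) m ⟩
      2 + r + m + m  ≡⟨ regroup r m ⟩
      r + 2 * suc m  ≤⟨ above ⟩
      n              ∎))
      where
      open ≤-Reasoning
      regroup : ∀ r m → 2 + r + m + m ≡ r + 2 * suc m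
      regroup = solve-∀

    old-window : ∀ {m r o e} i j → InWindow (2 + m) r (suc o + m) e → i + δ e ≤ 2 → j ≤ 2 →
                 ∀ e′ → InWindow (suc m) (i + r) (j + o + m) e′
    old-window {m} {r} {o} {e} i j (window below above) i+δ≤2 j≤2 e′ =
      window column (m≤n⇒m≤o+n (δ e′) bottom)
      where
      open ≤-Reasoning
      column : j + o + m + suc m ≤ i + r
      column = begin
        j + o + m + suc m    ≤⟨ +-monoˡ-≤ (suc m) (+-monoˡ-≤ m (+-monoˡ-≤ o j≤2)) ⟩
        2 + o + m + suc m    ≡⟨ regroup o m ⟩
        suc o + m + (2 + m)  ≤⟨ below ⟩
        r                    ≤⟨ m≤n+m r i ⟩
        i + r                ∎
        where
        regroup : ∀ o m → 2 + o + m + suc m ≡ suc o + m + (2 + m)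
        regroup = solve-∀
      bottom : i + r + 2 * suc m ≤ n
      bottom = +-cancelˡ-≤ (δ e) _ _ (begin
        δ e + (i + r + 2 * suc m)    ≡⟨ regroup (δ e) i r m ⟩
        i + δ e + (r + 2 * suc m)    ≤⟨ +-monoˡ-≤ (r + 2 * suc m) i+δ≤2 ⟩
        2 + (r + 2 * suc m)          ≡⟨ regroup′ r m ⟩
        r + 2 * (2 + m)              ≤⟨ above ⟩
        δ e + n                      ∎)
        where
        regroup : ∀ d i r m → d + (i + r + 2 * suc m) ≡ i + d + (r + 2 * suc m)
        regroup = solve-∀
        regroup′ : ∀ r m → 2 + (r + 2 * suc m) ≡ r + 2 * (2 + m)
        regroup′ = solve-∀

    first-reduction : ∀ r d e → Interior n r d e → gridM n X 1 r d e ≡ 1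
    first-reduction r d e int =
      trans (replaceLeft-interior 1 (X 1) (reduce n allOne) e int) (reduce-allOne e int)

    base : Invariant 0
    base {o = o} eq w with trans eq (+-identityʳ o)
    base {r} {o = suc zero}    {L} _ (window below _) | refl =
      replaceLeft-corner 1 (X 1) (reduce n allOne) (m+n≤o⇒n≤o 1 below)
    base {r} {o = suc zero}    {R} _ w | refl = first-reduction r 1 R (window-R w)
    base {r} {o = suc zero}    {B} _ w | refl = first-reduction r 1 B (window-B w)
    base {r} {o = zero}        {L} _ w | refl = first-reduction r 0 L (λ ())
    base {r} {o = zero}        {R} _ w | refl = first-reduction r 0 R (window-R w)
    base {r} {o = zero}        {B} _ w | refl = first-reduction r 0 B (window-B w)
    base {r} {o = suc (suc o)} {L} _ w | refl = first-reduction r (2 + o) L (λ ())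
    base {r} {o = suc (suc o)} {R} _ w | refl = first-reduction r (2 + o) R (window-R w)
    base {r} {o = suc (suc o)} {B} _ w | refl = first-reduction r (2 + o) B (window-B w)

    module Step {m} (inv : Invariant m) where
      by-rule : ∀ {r} o e → Interior (n ∸ suc m) r (suc o + m) e → (e ≡ L → 0 < o + m) →
                InWindow (2 + m) r (suc o + m) e → gridM n X (2 + m) r (suc o + m) e ≡ slot (suc m) o e
      by-rule {r} o e int regular w = begin
        gridM n X (2 + m) r (suc o + m) e
          ≡⟨ replaceLeft-interior (2 + m) (X (2 + m)) (reduce (n ∸ suc m) (gridM n X (suc m))) e int ⟩
        reduce (n ∸ suc m) (gridM n X (suc m)) r (suc o + m) e
          ≡⟨ reduce-local m o (slot m) e int old ⟩
        rule (slot m o) (slot m (suc o)) (slot m (2 + o)) e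
          ≡⟨ slot-step m o e regular ⟩
        slot (suc m) o e ∎
        where
        open ≡-Reasoning
        old : ∀ i j → i + δ e ≤ 2 → j ≤ 2 → gridM n X (suc m) (i + r) (j + o + m) ≗ slot m (j + o)
        old i j i+δ≤2 j≤2 e′ = inv refl (old-window i j w i+δ≤2 j≤2 e′)

    step : ∀ m → Invariant m → ∀ {r} o e → InWindow (2 + m) r (suc o + m) e →
           gridM n X (2 + m) r (suc o + m) e ≡ slot (suc m) o e
    step m       inv o       R w = Step.by-rule inv o R (window-R w) (λ ()) w
    step m       inv o       B w = Step.by-rule inv o B (window-B w) (λ ()) w
    step m       inv (suc o) L w = Step.by-rule inv (suc o) L (λ ()) (λ _ → s≤s z≤n) w
    step (suc m) inv zero    L w = Step.by-rule inv zero L (λ ()) (λ _ → s≤s z≤n) w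
    step zero    inv zero    L w =
      replaceLeft-corner 2 (X 2) (reduce (n ∸ 1) (gridM n X 1)) (InWindow.below-diagonal w)

    invariant : ∀ m → Invariant m
    invariant zero    = base
    invariant (suc m) {o = o} eq w with trans eq (+-suc o m)
    ... | refl = step m (invariant m) o _ w

    CM₂≡γ : ∀ k → 4 * (2 + k) ∸ 2 ≤ n → CM n X 2 (2 + k) ≡ γ k
    CM₂≡γ k 4s-2≤n = invariant (suc k) {o = 0} refl (window below above)
      where
      open ≤-Reasoning
      below : suc k + (2 + k) ≤ 2 * (2 + k) ∸ 1
      below = ≤-reflexive (regroup k)
        where
        regroup : ∀ k → suc k + (2 + k) ≡ suc (k + (2 + k + 0))
        regroup = solve-∀
      above : 2 * (2 + k) ∸ 1 + 2 * (2 + k) ≤ 1 + n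
      above = begin
        2 * (2 + k) ∸ 1 + 2 * (2 + k)  ≡⟨ regroup k ⟩
        1 + (k + 3 * (2 + k))          ≤⟨ +-monoʳ-≤ 1 4s-2≤n ⟩
        1 + n                          ∎
        where
        regroup : ∀ k → suc (k + (2 + k + 0)) + 2 * (2 + k) ≡ 1 + (k + 3 * (2 + k))
        regroup = solve-∀

module ClosedForms where
  open Literals
  open import Defs using (Δ; Yf; _÷'_; ιℤ; c; cM2)
  open RationalAlgebra
  open RowReduction using (module Profile)
  open import Data.Integer as ℤ using (+_; -[1+_])
  open import Data.List using (_∷_; [])
  open import Data.Nat as ℕ using (ℕ; zero; suc)
  import Data.Nat.Properties as ℕ
  import Data.Nat.Tactic.RingSolver as ℕ-Solver
  open import Data.Rational using (ℚ; _+_; _*_; _-_; Positive)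
  open import Data.Rational.Properties using (+-comm; pos+pos⇒pos; pos*pos⇒pos; normalize-pos)
  open import Relation.Binary.PropositionalEquality
  open import Tactic.RingSolver using (solve-∀; solve)

  -- The INLINE pragma lets the ring solver see through `numerator`.
  numerator : ℚ → ℚ → ℚ → ℚ → ℚ
  numerator U T x y = -1 + 9 * (U * U) - (8 + 16 * T) * U + 4 * U * y + (2 + (16 * T - 2) * U) * x
                      + 4 * U * x * y + (U - 1) * x * x + U * x * x * y
  {-# INLINE numerator #-}

  numerator-step : ∀ U T x y →
    2 * (9 * U - 1 + x) * (3 * (9 * U) - 1 + x) + 6 * (3 * U - 1 + x) * (9 * U - 1 + x)
      + 9 * numerator U T x y ≡ numerator (9 * U) (T + 1) x y
  numerator-step = solve-∀ ℚ-ring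

  -- γ′ = 2Q + Q²(2b + γ)/b²; then substitute 3Db = S, QD′ = S and γD² = N.
  γ-step : ∀ {γ′ γ b P Q S D D′ N} → Q * D′ ≡ S → b * (3 * D) ≡ S → P * (b + b + γ) ≡ b * b →
           γ′ * P ≡ P * Q + Q * Q + Q * P → γ * (D * D) ≡ N →
           γ′ * (D′ * D′) * (S * S) ≡ (2 * S * D′ + 6 * D * S + 9 * N) * (S * S)
  γ-step {γ′} {γ} {b} {P} {Q} {S} {D} {D′} {N} QD′≡S 3Db≡S hP hγ′ γD²≡N = begin
    γ′ * (D′ * D′) * (S * S)
      ≡⟨ cong (λ s → γ′ * (D′ * D′) * (s * s)) (sym 3Db≡S) ⟩
    γ′ * (D′ * D′) * (b * (3 * D) * (b * (3 * D)))
      ≡⟨ solve (γ′ ∷ b ∷ D ∷ D′ ∷ []) ℚ-ring ⟩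
    9 * (D * D) * (D′ * D′) * (γ′ * (b * b))
      ≡⟨ cong (λ z → 9 * (D * D) * (D′ * D′) * z) γ′b² ⟩
    9 * (D * D) * (D′ * D′) * (2 * Q * (b * b) + Q * Q * (b + b + γ))
      ≡⟨ solve (γ ∷ b ∷ Q ∷ D ∷ D′ ∷ []) ℚ-ring ⟩
    2 * (b * (3 * D)) * (b * (3 * D)) * (Q * D′) * D′
      + Q * D′ * (Q * D′) * (6 * D * (b * (3 * D)) + 9 * (γ * (D * D)))
      ≡⟨ cong₃ (λ s q n → 2 * s * s * q * D′ + q * q * (6 * D * s + 9 * n)) 3Db≡S QD′≡S γD²≡N ⟩
    2 * S * S * S * D′ + S * S * (6 * D * S + 9 * N)
      ≡⟨ solve (S ∷ D ∷ D′ ∷ N ∷ []) ℚ-ring ⟩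
    (2 * S * D′ + 6 * D * S + 9 * N) * (S * S) ∎
    where
    open ≡-Reasoning
    γ′b² : γ′ * (b * b) ≡ 2 * Q * (b * b) + Q * Q * (b + b + γ)
    γ′b² = linear-combination₂ (2 * Q - γ′) (b + b + γ) hP hγ′
             (solve (γ′ ∷ γ ∷ b ∷ P ∷ Q ∷ []) ℚ-ring)

  -- The numerator of cM2 as Defs writes it out, with its coefficients c replaced by d.
  bivariate-expand : ∀ {c₀₀ c₀₁ c₁₀ c₁₁ c₂₀ c₂₁ d₀₀ d₀₁ d₁₀ d₁₁ d₂₀ d₂₁ : ℚ} x y →
    c₀₀ ≡ d₀₀ → c₀₁ ≡ d₀₁ → c₁₀ ≡ d₁₀ → c₁₁ ≡ d₁₁ → c₂₀ ≡ d₂₀ → c₂₁ ≡ d₂₁ →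
    c₀₀ * 1 * 1 + c₀₁ * 1 * (y * 1) + 0 * 1 * (y * (y * 1))
      + c₁₀ * (x * 1) * 1 + c₁₁ * (x * 1) * (y * 1) + 0 * (x * 1) * (y * (y * 1))
      + c₂₀ * (x * (x * 1)) * 1 + c₂₁ * (x * (x * 1)) * (y * 1)
      + 0 * (x * (x * 1)) * (y * (y * 1))
    ≡ d₀₀ + d₀₁ * y + d₁₀ * x + d₁₁ * x * y + d₂₀ * x * x + d₂₁ * x * x * y
  bivariate-expand {d₀₀ = d₀₀} {d₀₁} {d₁₀} {d₁₁} {d₂₀} {d₂₁} x y refl refl refl refl refl refl =
    solve (d₀₀ ∷ d₀₁ ∷ d₁₀ ∷ d₁₁ ∷ d₂₀ ∷ d₂₁ ∷ x ∷ y ∷ []) ℚ-ring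

  81^n≡9^n*9^n : ∀ n → 81 ℕ.^ n ≡ 9 ℕ.^ n ℕ.* 9 ℕ.^ n
  81^n≡9^n*9^n zero    = refl
  81^n≡9^n*9^n (suc n) = trans (cong (81 ℕ.*_) (81^n≡9^n*9^n n)) (regroup (9 ℕ.^ n))
    where
    regroup : ∀ u → 81 ℕ.* (u ℕ.* u) ≡ 9 ℕ.* u ℕ.* (9 ℕ.* u)
    regroup = ℕ-Solver.solve-∀

  module _ (x y : ℚ) (x>0 : Positive x) (y>0 : Positive y) where
    open Profile x y

    -- For s = k + 2 these are the 9^(s-2) and s - 2 of the coefficients c_{i,j}(s).
    U T : ℕ → ℚ
    U k = ιℕ (9 ℕ.^ k)
    T k = ιℕ k

    D : ℕ → ℚ
    D k = 3 * U k - 1 + x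

    U-suc : ∀ k → U (suc k) ≡ 9 * U k
    U-suc k = ιℕ-homo-* 9 (9 ℕ.^ k)

    T-suc : ∀ k → T (suc k) ≡ T k + 1
    T-suc k = trans (ιℕ-homo-+ 1 k) (+-comm 1 (T k))

    U-positive : ∀ k → Positive (U k)
    U-positive k = normalize-pos (9 ℕ.^ k) 1 {{_}} {{ℕ.m^n≢0 9 k}}

    a-positive : ∀ k → Positive (a k)
    a-positive zero    = x>0
    a-positive (suc k) = Yf-positive (Δ 1 1 (a k)) ⅓ ⅓ {{Δ-positive 1 1 (a k) {{_}} {{_}} {{a-positive k}}}}

    spoke-positive : ∀ k → Positive (Δ 1 1 (a k))
    spoke-positive k = Δ-positive 1 1 (a k) {{_}} {{_}} {{a-positive k}}

    b-positive : ∀ k → Positive (b k)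
    b-positive k = Yf-positive ⅓ (Δ 1 1 (a k)) ⅓ {{_}} {{spoke-positive k}}

    γ-positive : ∀ k → Positive (γ k)
    γ-positive zero    = y>0
    γ-positive (suc k) = Yf-positive (Δ (b k) (b k) (γ k)) Q Q {{P>0}} {{Q>0}} {{Q>0}}
      where
      Q = Δ (a (suc k)) 1 1
      P>0 = Δ-positive (b k) (b k) (γ k) {{b-positive k}} {{b-positive k}} {{γ-positive k}}
      Q>0 = Δ-positive (a (suc k)) 1 1 {{a-positive (suc k)}}

    a-closed : ∀ k → a k * U k ≡ U k - 1 + x
    a-closed zero    = solve (x ∷ []) ℚ-ring
    a-closed (suc k) = subst (λ u → a (suc k) * u ≡ u - 1 + x) (sym (U-suc k))
      (step {a (suc k)} {Δ 1 1 (a k)} {a k} {U k}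
        (Yf-clear (Δ 1 1 (a k)) ⅓ ⅓ {{spoke-positive k}})
        (Δ-clear 1 1 (a k) {{_}} {{_}} {{a-positive k}})
        (a-closed k))
      where
      step : ∀ {a′ d a U} → a′ * d ≡ d * ⅓ + ⅓ * ⅓ + ⅓ * d → d * (1 + 1 + a) ≡ 1 * 1 →
             a * U ≡ U - 1 + x → a′ * (9 * U) ≡ 9 * U - 1 + x
      step {a′} {d} {a} {U} h₁ h₂ h₃ =
        linear-combination₃ (9 * U * (2 + a)) (U * (6 - 9 * a′)) 1 h₁ h₂ h₃
          (solve (a′ ∷ d ∷ a ∷ U ∷ x ∷ []) ℚ-ring)

    b-closed : ∀ k → b k * (3 * D k) ≡ 9 * U k - 1 + x
    b-closed k = step {b k} {Δ 1 1 (a k)} {a k} {U k}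
      (Yf-clear ⅓ (Δ 1 1 (a k)) ⅓) (Δ-clear 1 1 (a k) {{_}} {{_}} {{a-positive k}}) (a-closed k)
      where
      step : ∀ {b d a U} → b * ⅓ ≡ ⅓ * d + d * ⅓ + ⅓ * ⅓ → d * (1 + 1 + a) ≡ 1 * 1 →
             a * U ≡ U - 1 + x → b * (3 * (3 * U - 1 + x)) ≡ 9 * U - 1 + x
      step {b} {d} {a} {U} h₁ h₂ h₃ =
        linear-combination₃ (9 * U * (2 + a)) (6 * U) (1 - 3 * b) h₁ h₂ h₃
          (solve (b ∷ d ∷ a ∷ U ∷ x ∷ []) ℚ-ring)

    D-positive : ∀ k → Positive (D k)
    D-positive k = subst Positive (sym (factor {a k} {U k} (a-closed k)))
      (pos*pos⇒pos (U k) {{U-positive k}} (2 + a k) {{pos+pos⇒pos 2 (a k) {{a-positive k}}}})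
      where
      factor : ∀ {a U} → a * U ≡ U - 1 + x → 3 * U - 1 + x ≡ U * (2 + a)
      factor {a} {U} h = linear-combination₁ -1 h (solve (a ∷ U ∷ x ∷ []) ℚ-ring)

    γ-closed : ∀ k → γ k * (D k * D k) ≡ numerator (U k) (T k) x y
    γ-closed zero    = initial x y
      where
      initial : ∀ x y → y * ((3 * 1 - 1 + x) * (3 * 1 - 1 + x)) ≡ numerator 1 0 x y
      initial = solve-∀ ℚ-ring
    γ-closed (suc k) =
      subst₂ (λ u t → γ (suc k) * ((3 * u - 1 + x) * (3 * u - 1 + x)) ≡ numerator u t x y)
        (sym (U-suc k)) (sym (T-suc k)) (trans cleared (numerator-step (U k) (T k) x y))
      where
      P = Δ (b k) (b k) (γ k)
      Q = Δ (a (suc k)) 1 1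
      S = 9 * U k - 1 + x
      D′ = 3 * (9 * U k) - 1 + x
      a′-closed : a (suc k) * (9 * U k) ≡ S
      a′-closed = subst (λ u → a (suc k) * u ≡ u - 1 + x) (U-suc k) (a-closed (suc k))
      S>0 : Positive S
      S>0 = subst Positive a′-closed (pos*pos⇒pos (a (suc k)) {{a-positive (suc k)}} (9 * U k) {{9U>0}})
        where
        9U>0 = pos*pos⇒pos 9 (U k) {{U-positive k}}
      QD′≡S : Q * D′ ≡ S
      QD′≡S = step {Q} {a (suc k)} {U k} (Δ-clear (a (suc k)) 1 1 {{a-positive (suc k)}}) a′-closed
        where
        step : ∀ {Q a′ U} → Q * (a′ + 1 + 1) ≡ a′ * 1 → a′ * (9 * U) ≡ 9 * U - 1 + x →
               Q * (3 * (9 * U) - 1 + x) ≡ 9 * U - 1 + x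
        step {Q} {a′} {U} h₁ h₂ =
          linear-combination₂ (9 * U) (1 - Q) h₁ h₂ (solve (Q ∷ a′ ∷ U ∷ x ∷ []) ℚ-ring)
      cleared : γ (suc k) * (D′ * D′) ≡ 2 * S * D′ + 6 * D k * S + 9 * numerator (U k) (T k) x y
      cleared = *-cancelʳ-pos (S * S) {{pos*pos⇒pos S {{S>0}} S {{S>0}}}}
        (γ-step {γ (suc k)} {γ k} {b k} {P} {Q} {S} {D k} QD′≡S (b-closed k)
          (Δ-clear (b k) (b k) (γ k) {{b-positive k}} {{b-positive k}} {{γ-positive k}})
          (Yf-clear P Q Q {{P>0}}) (γ-closed k))
        where
        P>0 = Δ-positive (b k) (b k) (γ k) {{b-positive k}} {{b-positive k}} {{γ-positive k}}

    module _ (k : ℕ) where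
      private
        s = 2 ℕ.+ k

      c₀₀-cast : ιℤ (c 0 0 s) ≡ -1 + 9 * (U k * U k) - (8 + 16 * T k) * U k
      c₀₀-cast = begin
        ιℤ (c 0 0 s)
          ≡⟨ ιℤ-homo-− (-[1+ 0 ] ℤ.+ + (9 ℕ.* 81 ℕ.^ k)) (+ ((8 ℕ.+ 16 ℕ.* k) ℕ.* 9 ℕ.^ k)) ⟩
        ιℤ (-[1+ 0 ] ℤ.+ + (9 ℕ.* 81 ℕ.^ k)) - ιℕ ((8 ℕ.+ 16 ℕ.* k) ℕ.* 9 ℕ.^ k)
          ≡⟨ cong₂ _-_ (ιℤ-homo-+ -[1+ 0 ] (+ (9 ℕ.* 81 ℕ.^ k)))
                       (ιℕ-homo-* (8 ℕ.+ 16 ℕ.* k) (9 ℕ.^ k)) ⟩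
        -1 + ιℕ (9 ℕ.* 81 ℕ.^ k) - ιℕ (8 ℕ.+ 16 ℕ.* k) * U k
          ≡⟨ cong₂ (λ p q → -1 + p - q * U k) 9·81ᵏ
                   (trans (ιℕ-homo-+ 8 (16 ℕ.* k)) (cong (λ z → 8 + z) (ιℕ-homo-* 16 k))) ⟩
        -1 + 9 * (U k * U k) - (8 + 16 * T k) * U k ∎
        where
        open ≡-Reasoning
        9·81ᵏ : ιℕ (9 ℕ.* 81 ℕ.^ k) ≡ 9 * (U k * U k)
        9·81ᵏ = trans (ιℕ-homo-* 9 (81 ℕ.^ k))
                      (cong (9 *_) (trans (cong ιℕ (81^n≡9^n*9^n k)) (ιℕ-homo-* (9 ℕ.^ k) (9 ℕ.^ k))))

      4·9ᵏ-cast : ιℕ (4 ℕ.* 9 ℕ.^ k) ≡ 4 * U k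
      4·9ᵏ-cast = ιℕ-homo-* 4 (9 ℕ.^ k)

      c₁₀-cast : ιℤ (c 1 0 s) ≡ 2 + (16 * T k - 2) * U k
      c₁₀-cast = begin
        ιℤ (c 1 0 s)
          ≡⟨ ιℤ-homo-+ (+ 2) ((+ (16 ℕ.* k) ℤ.- + 2) ℤ.* + (9 ℕ.^ k)) ⟩
        2 + ιℤ ((+ (16 ℕ.* k) ℤ.- + 2) ℤ.* + (9 ℕ.^ k))
          ≡⟨ cong (λ z → 2 + z) (ιℤ-homo-* (+ (16 ℕ.* k) ℤ.- + 2) (+ (9 ℕ.^ k))) ⟩
        2 + ιℤ (+ (16 ℕ.* k) ℤ.- + 2) * U k
          ≡⟨ cong (λ p → 2 + p * U k)
                  (trans (ιℤ-homo-− (+ (16 ℕ.* k)) (+ 2)) (cong (_- 2) (ιℕ-homo-* 16 k))) ⟩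
        2 + (16 * T k - 2) * U k ∎
        where open ≡-Reasoning

      c₂₀-cast : ιℤ (c 2 0 s) ≡ U k - 1
      c₂₀-cast = ιℤ-homo-− (+ (9 ℕ.^ k)) (+ 1)

      c₂₁-cast : ιℤ (c 2 1 s) ≡ U k
      c₂₁-cast = refl

      cM2-closed : cM2 s x y ≡ numerator (U k) (T k) x y ÷' (D k * D k)
      cM2-closed = cong₂ _÷'_
        (bivariate-expand x y c₀₀-cast 4·9ᵏ-cast c₁₀-cast 4·9ᵏ-cast c₂₀-cast c₂₁-cast)
        (cong₂ _*_ denominator denominator)
        where
        denominator : ιℤ (+ (3 ℕ.* 9 ℕ.^ k) ℤ.- + 1) + x ≡ D k
        denominator = cong (_+ x) (trans (ιℤ-homo-− (+ (3 ℕ.* 9 ℕ.^ k)) (+ 1))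
                                         (cong (_- 1) (ιℕ-homo-* 3 (9 ℕ.^ k))))

    γ≡cM2 : ∀ k → γ k ≡ cM2 (2 ℕ.+ k) x y
    γ≡cM2 k = trans (÷'-unique (D k * D k) {{D²>0}} (γ-closed k)) (sym (cM2-closed k))
      where
      D²>0 = pos*pos⇒pos (D k) {{D-positive k}} (D k) {{D-positive k}}

open import Defs
open import Data.Nat using (ℕ; _≤_; _∸_; _*_)
open import Data.Integer as ℤ using (+_)
open import Data.Rational using (ℚ; Positive)
open import Data.Product using (_×_)
open import Function using (_∘_)
open import Relation.Binary.PropositionalEquality using (_≡_)

open import Data.Nat using (suc; s≤s; z≤n)
open import Data.Product using (_,_)
open import Relation.Binary.PropositionalEquality using (trans)
open ShiftOperators
  using ( c₀₀-annihilated; c₀₁-annihilated; c₁₀-annihilated; c₁₁-annihilated; c₂₀-annihilated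
        ; c₂₁-annihilated; recurrence₁; recurrence₂; recurrence₃; recurrence₄ )
open RowReduction using (module Grid)
open ClosedForms using (γ≡cM2)

CM₂-closed : ∀ s → 2 ≤ s → ∀ n → 4 * s ∸ 2 ≤ n → (X : ℕ → ℚ) → (∀ i → 1 ≤ i → Positive (X i)) →
             CM n X 2 s ≡ cM2 s (X 1) (X 2)
CM₂-closed (suc (suc k)) (s≤s (s≤s z≤n)) n 4s-2≤n X X>0 =
  trans (Grid.CM₂≡γ n X k 4s-2≤n) (γ≡cM2 (X 1) (X 2) (X>0 1 (s≤s z≤n)) (X>0 2 (s≤s z≤n)) k)

corollary4p12 :
  -- (a) annihilators and recurrences
  ( (Annihilates ((E- (+ 81)) ∘ (E- (+ 9)) ∘ (E- (+ 9)) ∘ (E- (+ 1))) (c 0 0)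
     × (∀ s → 6 ≤ s → c 0 0 s ≡ + 100 ℤ.* c 0 0 (s ∸ 1) ℤ.- + 1638 ℤ.* c 0 0 (s ∸ 2)
                                 ℤ.+ + 8100 ℤ.* c 0 0 (s ∸ 3) ℤ.- + 6561 ℤ.* c 0 0 (s ∸ 4)))
  × (Annihilates ((E- (+ 1)) ∘ (E- (+ 9))) (c 0 1)
     × (∀ s → 4 ≤ s → c 0 1 s ≡ + 10 ℤ.* c 0 1 (s ∸ 1) ℤ.- + 9 ℤ.* c 0 1 (s ∸ 2)))
  × (Annihilates ((E- (+ 9)) ∘ (E- (+ 9)) ∘ (E- (+ 1))) (c 1 0)
     × (∀ s → 5 ≤ s → c 1 0 s ≡ + 19 ℤ.* c 1 0 (s ∸ 1) ℤ.- + 99 ℤ.* c 1 0 (s ∸ 2)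
                                 ℤ.+ + 81 ℤ.* c 1 0 (s ∸ 3)))
  × (Annihilates (E- (+ 9)) (c 1 1)
     × (∀ s → 3 ≤ s → c 1 1 s ≡ + 9 ℤ.* c 1 1 (s ∸ 1)))
  × (Annihilates ((E- (+ 1)) ∘ (E- (+ 9))) (c 2 0)
     × (∀ s → 4 ≤ s → c 2 0 s ≡ + 10 ℤ.* c 2 0 (s ∸ 1) ℤ.- + 9 ℤ.* c 2 0 (s ∸ 2)))
  × (Annihilates (E- (+ 9)) (c 2 1)
     × (∀ s → 3 ≤ s → c 2 1 s ≡ + 9 ℤ.* c 2 1 (s ∸ 1))) )
  ×
  -- (b) C^M_{2,s} = c^M_2(s, X1, X2), for every s ≥ 2, on any n-grid with
  -- n ≥ 4s-2, at every positive rational point X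
  (∀ s → 2 ≤ s → ∀ n → 4 * s ∸ 2 ≤ n → (X : ℕ → ℚ) →
     (∀ i → 1 ≤ i → Positive (X i)) →
     CM n X 2 s ≡ cM2 s (X 1) (X 2))
corollary4p12 =
  ( (c₀₀-annihilated , recurrence₄ (+ 81) (+ 9) (+ 9) (+ 1) (c 0 0) c₀₀-annihilated)
  , (c₀₁-annihilated , recurrence₂ (+ 1) (+ 9) (c 0 1) c₀₁-annihilated)
  , (c₁₀-annihilated , recurrence₃ (+ 9) (+ 9) (+ 1) (c 1 0) c₁₀-annihilated)
  , (c₁₁-annihilated , recurrence₁ (+ 9) (c 1 1) c₁₁-annihilated)
  , (c₂₀-annihilated , recurrence₂ (+ 1) (+ 9) (c 2 0) c₂₀-annihilated)
  , (c₂₁-annihilated , recurrence₁ (+ 9) (c 2 1) c₂₁-annihilated) )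
  , CM₂-closed
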